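{- Let $G$ be a serial superedge with terminals $s=s_1,s_2,\dots,s_{k+1}=t$, i.e. an oriented serial superedge $(G,s,t)$ with principal subgraphs $(G_i,s_i,s_{i+1})$ for $1\le i\le k$, each $G_i$ non-serial. Suppose that for every $1\le i\le k$ there is a graph isomorphism $r_i:G_i\to G_{k-i+1}$ with $r_i(s_i)=s_{k-i+2}$ and $r_i(s_{i+1})=s_{k-i+1}$, and let $r:V(G)\to V(G)$ be the map whose restriction to $V(G_i)$ is $r_i$ for each $i$. Then $\mathrm{Aut}_{\mathrm{semi}}(G,\{s,t\})=\{\sigma,\ r\sigma:\sigma\in\mathrm{Aut}_{\mathrm{or}}(G,s,t)\}$. If no such family of isomorphisms $r_1,\dots,r_k$ exists, then $\mathrm{Aut}_{\mathrm{semi}}(G,\{s,t\})=\mathrm{Aut}_{\mathrm{or}}(G,s,t)$.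
   Context: All graphs are finite, simple and undirected. An oriented series-parallel graph is a triple $(G,s,t)$ where $G$ is a graph and $s\neq t$ are vertices, defined recursively: (i) $G$ is a single edge with vertex set $\{s,t\}$; or (ii) (serial superedge) there are $k\ge 2$ oriented series-parallel graphs $(G_1,s_1,t_1),\dots,(G_k,s_k,t_k)$ with $s_1=s$, $t_k=t$, $t_i=s_{i+1}$ for $1\le i<k$, $V(G_i)\cap V(G_{i+1})=\{s_{i+1}\}$, $V(G_i)\cap V(G_j)=\emptyset$ for $|i-j|\ge2$, and $G=G_1\cup\dots\cup G_k$; or (iii) (parallel superedge) there are $k\ge2$ oriented series-parallel graphs $(G_1,s,t),\dots,(G_k,s,t)$ with $V(G_i)\cap V(G_j)=\{s,t\}$ for $i\neq j$ and $G=G_1\cup\dots\cup G_k$. The $G_i$ are the principal subgraphs; a graph is non-serial if it is not a serial superedge. $\mathrm{Aut}_{\mathrm{or}}(G,s,t)$ is the group of automorphisms $\sigma$ of $G$ with $\sigma(s)=s$, $\sigma(t)=t$; $\mathrm{Aut}_{\mathrm{semi}}(G,\{s,t\})$ is the group of automorphisms $\sigma$ of $G$ with $\{\sigma(s),\sigma(t)\}=\{s,t\}$. -}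

module Defs where

open import Data.Fin using (Fin; zero; suc; inject₁; fromℕ; toℕ; opposite)
open import Data.Fin.Subset using (Subset; _∈_; _∉_; _∩_; _∪_; ⁅_⁆; ⊥)
open import Data.Fin.Subset.Properties using (x∈⁅x⁆; x∈p∪q⁺)
open import Data.Nat using (ℕ; suc; _≤_; s≤s; ∣_-_∣)
open import Data.Product using (∃; _×_; _,_; proj₁)
open import Data.Sum using (_⊎_; inj₁; inj₂)
open import Function using (_∘_; _⇔_; Equivalence)
open import Function.Definitions using (Bijective)
open import Level using (0ℓ)
open import Relation.Binary.PropositionalEquality using (_≡_; _≢_; _≗_; refl; sym; subst)
open import Relation.Nullary using (¬_)
open import Relation.Unary using (Pred)

-- All graphs occurring in one decomposition have their vertices in a common
-- finite set of labels Fin n, so that unions and intersections of vertex sets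
-- are the literal ones.  The vertex set V of a graph may be any subset of the
-- labels.  N u is the set of neighbours of u.
record Graph (n : ℕ) : Set where
  field
    V        : Subset n
    N        : Fin n → Subset n
    N-sym    : ∀ {u v} → v ∈ N u → u ∈ N v
    N-irrefl : ∀ {u} → u ∉ N u
    N⊆V      : ∀ {u v} → v ∈ N u → v ∈ V

open Graph public

Adj : ∀ {n} → Graph n → Fin n → Fin n → Set
Adj G u v = v ∈ N G u

Vertex : ∀ {n} → Graph n → Set
Vertex G = ∃ λ v → v ∈ V G

pair : ∀ {n} → Fin n → Fin n → Subset n
pair u v = ⁅ u ⁆ ∪ ⁅ v ⁆

record IsUnion {n k} (G : Graph n) (H : Fin k → Graph n) : Set where
  field
    vertices : ∀ v → v ∈ V G ⇔ (∃ λ i → v ∈ V (H i))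
    edges    : ∀ u v → Adj G u v ⇔ (∃ λ i → Adj (H i) u v)

record IsEdge {n} (G : Graph n) (s t : Fin n) : Set where
  field
    s≢t      : s ≢ t
    vertices : V G ≡ pair s t
    adjacent : Adj G s t

data SeriesParallel {n} (G : Graph n) (s t : Fin n) : Set
record Serial   {n} (G : Graph n) (s t : Fin n) : Set
record Parallel {n} (G : Graph n) (s t : Fin n) : Set

data SeriesParallel G s t where
  edge     : IsEdge G s t   → SeriesParallel G s t
  serial   : Serial G s t   → SeriesParallel G s t
  parallel : Parallel G s t → SeriesParallel G s t

-- Indices start at 0: part i has terminals node i and node (i + 1), so the
-- sequence node enforces that the end of each part is the start of the next.
record Serial G s t where
  inductive
  field
    s≢t         : s ≢ t
    k           : ℕ
    2≤k         : 2 ≤ k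
    part        : Fin k → Graph _
    node        : Fin (suc k) → Fin _
    node-first  : node zero ≡ s
    node-last   : node (fromℕ k) ≡ t
    part-sp     : ∀ i → SeriesParallel (part i) (node (inject₁ i)) (node (suc i))
    consecutive : ∀ i j → toℕ j ≡ suc (toℕ i) →
                  V (part i) ∩ V (part j) ≡ ⁅ node (inject₁ j) ⁆
    distant     : ∀ i j → 2 ≤ ∣ toℕ i - toℕ j ∣ → V (part i) ∩ V (part j) ≡ ⊥
    union       : IsUnion G part

record Parallel G s t where
  inductive
  field
    s≢t     : s ≢ t
    k       : ℕ
    2≤k     : 2 ≤ k
    part    : Fin k → Graph _
    part-sp : ∀ i → SeriesParallel (part i) s t
    meet    : ∀ i j → i ≢ j → V (part i) ∩ V (part j) ≡ pair s t
    union   : IsUnion G part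

NonSerial : ∀ {n} → Graph n → Fin n → Fin n → Set
NonSerial G s t = ¬ Serial G s t

source∈ : ∀ {n} {G : Graph n} {s t} → SeriesParallel G s t → s ∈ V G
source∈ {s = s} (edge e) =
  subst (s ∈_) (sym (IsEdge.vertices e)) (x∈p∪q⁺ (inj₁ (x∈⁅x⁆ s)))
source∈ (serial record { 2≤k = s≤s _ ; node-first = refl ; part-sp = sp ; union = un }) =
  Equivalence.from (IsUnion.vertices un _) (zero , source∈ (sp zero))
source∈ (parallel record { 2≤k = s≤s _ ; part-sp = sp ; union = un }) =
  Equivalence.from (IsUnion.vertices un _) (zero , source∈ (sp zero))

target∈ : ∀ {n} {G : Graph n} {s t} → SeriesParallel G s t → t ∈ V G
target∈ {t = t} (edge e) =
  subst (t ∈_) (sym (IsEdge.vertices e)) (x∈p∪q⁺ (inj₂ (x∈⁅x⁆ t)))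
target∈ (serial record { k = suc m ; node-last = refl ; part-sp = sp ; union = un }) =
  Equivalence.from (IsUnion.vertices un _) (fromℕ m , target∈ (sp (fromℕ m)))
target∈ (parallel record { 2≤k = s≤s _ ; part-sp = sp ; union = un }) =
  Equivalence.from (IsUnion.vertices un _) (zero , target∈ (sp zero))

source target : ∀ {n} {G : Graph n} {s t} → SeriesParallel G s t → Vertex G
source {s = s} sp = s , source∈ sp
target {t = t} sp = t , target∈ sp

record IsIso {n} (G H : Graph n) (f : Vertex G → Vertex H) : Set where
  field
    bijective : Bijective _≡_ _≡_ f
    adjacency : ∀ u v → Adj G (proj₁ u) (proj₁ v) ⇔ Adj H (proj₁ (f u)) (proj₁ (f v))

-- The automorphism groups are given by their underlying sets of maps.
AutOr AutSemi : ∀ {n} (G : Graph n) (s t : Vertex G) → Pred (Vertex G → Vertex G) 0ℓ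
AutOr   G s t σ = IsIso G G σ × σ s ≡ s × σ t ≡ t
AutSemi G s t σ = IsIso G G σ ×
  pair (proj₁ (σ s)) (proj₁ (σ t)) ≡ pair (proj₁ s) (proj₁ t)

-- The set { σ , r σ : σ ∈ A }, with maps compared pointwise.
WithReversed : {X : Set} → (X → X) → Pred (X → X) 0ℓ → Pred (X → X) 0ℓ
WithReversed r A φ = ∃ λ σ → A σ × (φ ≗ σ ⊎ φ ≗ r ∘ σ)

module _ {n} {G : Graph n} {s t : Fin n} (D : Serial G s t) where
  open Serial D

  include : ∀ i → Vertex (part i) → Vertex G
  include i (v , v∈) = v , Equivalence.from (IsUnion.vertices union v) (i , v∈)

  -- With 0-based indices, opposite i is the index k - 1 - i.
  record Reversal : Set where
    field
      ρ        : ∀ i → Vertex (part i) → Vertex (part (opposite i))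
      ρ-iso    : ∀ i → IsIso (part i) (part (opposite i)) (ρ i)
      ρ-source : ∀ i → ρ i (source (part-sp i)) ≡ target (part-sp (opposite i))
      ρ-target : ∀ i → ρ i (target (part-sp i)) ≡ source (part-sp (opposite i))

  RestrictsTo : Reversal → (Vertex G → Vertex G) → Set
  RestrictsTo R r = ∀ i v → r (include i v) ≡ include (opposite i) (Reversal.ρ R i v)

module Submission where

{-
The r_i agree on the shared terminals, so they define an
isomorphism r of G swapping s and t, and an automorphism φ that swaps s and t
equals r ∘ (r⁻¹ ∘ φ).

Conversely, the serial decomposition is rigid.  A non-serial part has, for
every vertex c other than its terminals, a walk between its terminals that
avoids c.  So the nodes s_i are exactly the vertices that every walk from s to
t has to pass through.  Moreover V(G_1) ∪ … ∪ V(G_i) is the set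
of vertices that can be reached from s without leaving s_{i+1}, so the position
of each node, and each V(G_i), is determined by (G, s, t).  An automorphism
swapping s and t is an isomorphism onto the reversed decomposition, hence it
induces the isomorphisms r_i.
-}

open import Data.Fin using (Fin; zero; suc; inject₁; fromℕ; toℕ; opposite; _≤_; _<_; fromℕ<)
open import Data.Fin.Induction using (<-weakInduction; >-weakInduction)
open import Data.Fin.Properties
  using (_≟_; any?; toℕ-injective; toℕ-inject₁; toℕ-fromℕ; toℕ<n;
         ≤fromℕ; <-cmp; opposite-prop; opposite-involutive)
open import Data.Fin.Relation.Unary.Top using (view; ‵fromℕ; ‵inject₁)
open import Data.Fin.Subset using (_∈_; _∉_)
open import Data.Fin.Subset.Properties
  using (_∈?_; ∉⊥; x∈⁅x⁆; x∈⁅y⁆⇒x≡y; x∈p∩q⁺; x∈p∪q⁺; x∈p∪q⁻; ∪-comm)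
open import Data.Nat as ℕ using (ℕ; s≤s; z≤n)
import Data.Nat.Properties as ℕ
open import Data.Product using (∃; _×_; _,_; proj₁; proj₂)
open import Data.Sum as Sum using (_⊎_; inj₁; inj₂)
open import Data.Vec.Properties.WithK using ([]=-irrelevant)
open import Function using (_∘_; _⇔_; mk⇔; Equivalence)
open import Relation.Binary using (tri<; tri≈; tri>)
open import Relation.Binary.Construct.Closure.ReflexiveTransitive
  using (Star; ε; _◅_; _◅◅_)
import Relation.Binary.Construct.Closure.ReflexiveTransitive as Star
open import Relation.Binary.PropositionalEquality
open import Relation.Nullary using (¬_; yes; no; contradiction)
open import Relation.Unary using (_≐_)
open import Defs

private variable
  n k     : ℕ
  G H     : Graph n
  s t u v w : Fin n

-- Vertices and isomorphisms

-- Membership in a subset has at most one proof, so labels alone decide equality of vertices.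
vertex-≡ : {u v : Vertex G} → proj₁ u ≡ proj₁ v → u ≡ v
vertex-≡ {u = u , p} {.u , q} refl = cong (u ,_) ([]=-irrelevant p q)

edge-source∈ : (G : Graph n) → Adj G u v → u ∈ V G
edge-source∈ G = N⊆V G ∘ N-sym G

edge-target∈ : (G : Graph n) → Adj G u v → v ∈ V G
edge-target∈ G = N⊆V G

∈pair⁻ : w ∈ pair u v → w ≡ u ⊎ w ≡ v
∈pair⁻ = Sum.map (x∈⁅y⁆⇒x≡y _) (x∈⁅y⁆⇒x≡y _) ∘ x∈p∪q⁻ _ _

∈pair⁺ : w ≡ u ⊎ w ≡ v → w ∈ pair u v
∈pair⁺ {u = u} (inj₁ refl) = x∈p∪q⁺ (inj₁ (x∈⁅x⁆ u))
∈pair⁺ {v = v} (inj₂ refl) = x∈p∪q⁺ (inj₂ (x∈⁅x⁆ v))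

module _ {f : Vertex G → Vertex H} (f-iso : IsIso G H f) where
  open IsIso f-iso

  iso-injective : ∀ {u v} → f u ≡ f v → u ≡ v
  iso-injective = proj₁ bijective

  iso-adj : ∀ {u v} → Adj G (proj₁ u) (proj₁ v) → Adj H (proj₁ (f u)) (proj₁ (f v))
  iso-adj = Equivalence.to (adjacency _ _)

  inverse : Vertex H → Vertex G
  inverse y = proj₁ (proj₂ bijective y)

  inverseʳ : ∀ y → f (inverse y) ≡ y
  inverseʳ y = proj₂ (proj₂ bijective y) refl

  inverseˡ : ∀ x → inverse (f x) ≡ x
  inverseˡ x = iso-injective (inverseʳ (f x))

  inverse-iso : IsIso H G inverse
  inverse-iso = record
    { bijective = (λ {x} {y} eq → trans (sym (inverseʳ x)) (trans (cong f eq) (inverseʳ y)))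
                , λ x → f x , λ { refl → inverseˡ x }
    ; adjacency = λ u v → mk⇔
        (λ e → Equivalence.from (adjacency _ _)
          (subst₂ (λ x y → Adj H (proj₁ x) (proj₁ y)) (sym (inverseʳ u)) (sym (inverseʳ v)) e))
        (λ e → subst₂ (λ x y → Adj H (proj₁ x) (proj₁ y)) (inverseʳ u) (inverseʳ v) (iso-adj e))
    }

iso-∘ : ∀ {m} {A B C : Graph m} {g : Vertex B → Vertex C} {f : Vertex A → Vertex B} →
        IsIso B C g → IsIso A B f → IsIso A C (g ∘ f)
iso-∘ {g = g} {f} I J = record
  { bijective = iso-injective J ∘ iso-injective I
              , λ z → inverse J (inverse I z) ,
                      λ { refl → trans (cong g (inverseʳ J _)) (inverseʳ I z) }
  ; adjacency = λ u v → mk⇔ (iso-adj I ∘ iso-adj J)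
      (Equivalence.from (IsIso.adjacency J u v) ∘ Equivalence.from (IsIso.adjacency I _ _))
  }

iso-≗ : {f g : Vertex G → Vertex H} → f ≗ g → IsIso G H g → IsIso G H f
iso-≗ {G = G} {H = H} f≗g I = record
  { bijective = (λ {x} {y} eq → iso-injective I (trans (sym (f≗g x)) (trans eq (f≗g y))))
              , λ y → inverse I y , λ { refl → trans (f≗g _) (inverseʳ I y) }
  ; adjacency = λ u v → subst₂ (λ x y → Adj G (proj₁ u) (proj₁ v) ⇔ Adj H (proj₁ x) (proj₁ y))
      (sym (f≗g u)) (sym (f≗g v)) (IsIso.adjacency I u v)
  }

-- Walks

-- Walks in G that never leave c; they may end there.
Reach : Graph n → Fin n → Fin n → Fin n → Set
Reach G c = Star (λ x y → x ≢ c × Adj G x y)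

-- Here, unlike in `Reach`, both ends of each step differ from `c`, which makes the step relation
-- symmetric and walks reversible.
Bypass : Graph n → Fin n → Fin n → Fin n → Set
Bypass G c = Star (λ x y → x ≢ c × y ≢ c × Adj G x y)

bypass-reverse : ∀ {c} (G : Graph n) → Bypass G c u v → Bypass G c v u
bypass-reverse G = Star.reverse λ (p , q , e) → q , p , N-sym G e

reach⇒bypass : ∀ {c d} (G : Graph n) → d ∉ V G → Reach G c u v → Bypass G d u v
reach⇒bypass G d∉ = Star.map λ (_ , e) →
  (λ { refl → d∉ (edge-source∈ G e) }) , (λ { refl → d∉ (edge-target∈ G e) }) , e

iso-reach : {f : Vertex G → Vertex H} → IsIso G H f → ∀ {c u v : Vertex G} →
            Reach G (proj₁ c) (proj₁ u) (proj₁ v) →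
            Reach H (proj₁ (f c)) (proj₁ (f u)) (proj₁ (f v))
iso-reach {G = G} {H = H} {f = f} I {c} {u} {v} = go u v
  where
  go : ∀ (u v : Vertex G) → Reach G (proj₁ c) (proj₁ u) (proj₁ v) →
       Reach H (proj₁ (f c)) (proj₁ (f u)) (proj₁ (f v))
  go (u , p) (.u , q) ε = subst (λ r → Reach H _ _ (proj₁ (f (u , r)))) ([]=-irrelevant p q) ε
  go u v ((u≢c , e) ◅ ws) =
    ( (λ eq → u≢c (cong proj₁ (iso-injective I (vertex-≡ {G = H} eq)))) , iso-adj I e)
    ◅ go (_ , edge-target∈ G e) v ws

-- Indices

opposite-inject₁ : (i : Fin k) → opposite (inject₁ i) ≡ suc (opposite i)
opposite-inject₁ i = begin
  -- `opposite (suc j)` reduces to `inject₁ (opposite j)`, so the next two expressions agree by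
  -- computation.
  opposite (inject₁ i)                       ≡⟨ cong (opposite ∘ inject₁) (opposite-involutive i) ⟨
  opposite (opposite (suc (opposite i)))     ≡⟨ opposite-involutive (suc (opposite i)) ⟩
  suc (opposite i)                           ∎
  where open ≡-Reasoning

opposite-injective : {i j : Fin k} → opposite i ≡ opposite j → i ≡ j
opposite-injective {i = i} {j} eq =
  trans (sym (opposite-involutive i)) (trans (cong opposite eq) (opposite-involutive j))

opposite-anti-< : {i j : Fin k} → i < j → opposite j < opposite i
opposite-anti-< {k = k} {i = i} {j} i<j = subst₂ ℕ._<_ (sym (opposite-prop j)) (sym (opposite-prop i))
  (ℕ.∸-monoʳ-< (s≤s i<j) (toℕ<n j))

inject₁≡suc : {i j : Fin k} → toℕ j ≡ ℕ.suc (toℕ i) → inject₁ j ≡ suc i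
inject₁≡suc {j = j} eq = toℕ-injective (trans (toℕ-inject₁ j) eq)

inject₁-or-suc : Fin k → (c : Fin (ℕ.suc k)) → (∃ λ j → c ≡ inject₁ j) ⊎ (∃ λ j → c ≡ suc j)
inject₁-or-suc _       (suc j) = inj₂ (j , refl)
inject₁-or-suc zero    zero    = inj₁ (zero , refl)
inject₁-or-suc (suc _) zero    = inj₁ (zero , refl)

-- Upward induction from the least index gives one inequality, downward induction from the greatest
-- gives the other.
strictMono⇒id : (π : Fin (ℕ.suc k) → Fin (ℕ.suc k)) → (∀ {i j} → i < j → π i < π j) →
                ∀ i → π i ≡ i
strictMono⇒id {k} π mono i = toℕ-injective (ℕ.≤-antisym (below i) (above i))
  where
  inject₁<suc : (i : Fin k) → inject₁ i < suc i
  inject₁<suc i = s≤s (ℕ.≤-reflexive (toℕ-inject₁ i))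

  above : ∀ i → i ≤ π i
  above = <-weakInduction (λ i → i ≤ π i) z≤n λ i ih →
    ℕ.≤-trans (s≤s (subst (ℕ._≤ toℕ (π (inject₁ i))) (toℕ-inject₁ i) ih)) (mono (inject₁<suc i))

  below : ∀ i → π i ≤ i
  below = >-weakInduction (λ i → π i ≤ i) (≤fromℕ _) λ i ih →
    subst (toℕ (π (inject₁ i)) ℕ.≤_) (sym (toℕ-inject₁ i)) (ℕ.s≤s⁻¹ (ℕ.≤-trans (mono (inject₁<suc i)) ih))

-- Chains

-- What the argument retains of a series-parallel graph. The conditions are symmetric in the two
-- terminals, so that chains can be reversed.
record Link (G : Graph n) (s t : Fin n) : Set where
  field
    source∈V : s ∈ V G
    target∈V : t ∈ V G
    distinct : s ≢ t
    fromSource : ∀ {v} → v ∈ V G → Reach G t s v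
    fromTarget : ∀ {v} → v ∈ V G → Reach G s t v

link-reverse : Link G s t → Link G t s
link-reverse L = record
  { source∈V = target∈V ; target∈V = source∈V ; distinct = distinct ∘ sym
  ; fromSource = fromTarget ; fromTarget = fromSource }
  where open Link L

-- A serial decomposition in a form closed under reversal. The conditions on consecutive and on
-- distant parts are merged into `meet`, where `inject₁ j ≡ suc i` says that part `j` comes right
-- after part `i`.
record Chain (G : Graph n) (k : ℕ) : Set where
  field
    part    : Fin k → Graph n
    node    : Fin (ℕ.suc k) → Fin n
    link    : ∀ i → Link (part i) (node (inject₁ i)) (node (suc i))
    meet    : ∀ {i j v} → i < j → v ∈ V (part i) → v ∈ V (part j) →
              inject₁ j ≡ suc i × v ≡ node (suc i)
    union   : IsUnion G part

  module _ {i : Fin k} where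
    open Link (link i) public

  incl : ∀ i → Vertex (part i) → Vertex G
  incl i (v , p) = v , Equivalence.from (IsUnion.vertices union v) (i , p)

  -- The argument of type `Fin k` rules out the empty chain, whose only node lies in no part.
  node∈ : Fin k → ∀ c → node c ∈ V G
  node∈ i c with inject₁-or-suc i c
  ... | inj₁ (_ , refl) = proj₂ (incl _ (_ , source∈V))
  ... | inj₂ (_ , refl) = proj₂ (incl _ (_ , target∈V))

  locate : (v : Vertex G) → ∃ λ i → proj₁ v ∈ V (part i)
  locate (v , p) = Equivalence.to (IsUnion.vertices union v) p

  part-adj : ∀ {i u v} → Adj (part i) u v → Adj G u v
  part-adj e = Equivalence.from (IsUnion.edges union _ _) (_ , e)

  locate-adj : ∀ {u v} → Adj G u v → ∃ λ i → Adj (part i) u v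
  locate-adj e = Equivalence.to (IsUnion.edges union _ _) e

  -- The only vertex that a part can share with an earlier one is its source, which differs from its
  -- target.
  later-node∉ : ∀ {i j} → i < j → node (suc j) ∉ V (part i)
  later-node∉ i<j p with eq , at ← meet i<j p target∈V =
    distinct (trans (cong node eq) (sym at))

  node-injective-< : ∀ {a b} → a < b → node a ≢ node b
  node-injective-< {a} {suc b} a<b eq with view a
  ... | ‵fromℕ = ℕ.<⇒≱ a<b (≤fromℕ (suc b))
  ... | ‵inject₁ a with <-cmp a b
  ...   | tri< a<b _ _ = later-node∉ a<b (subst (_∈ V (part a)) eq source∈V)
  ...   | tri≈ _ refl _ = distinct eq
  ...   | tri> _ _ b<a = ℕ.<⇒≱ b<a (subst (ℕ._≤ toℕ b) (toℕ-inject₁ a) (ℕ.s≤s⁻¹ a<b))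

  node-injective : ∀ {a b} → node a ≡ node b → a ≡ b
  node-injective {a} {b} eq with <-cmp a b
  ... | tri< a<b _ _ = contradiction eq (node-injective-< a<b)
  ... | tri≈ _ a≡b _ = a≡b
  ... | tri> _ _ b<a = contradiction (sym eq) (node-injective-< b<a)

  shared : ∀ {i j v} → v ∈ V (part i) → v ∈ V (part j) → i ≡ j ⊎ ∃ λ c → v ≡ node c
  shared {i} {j} p q with <-cmp i j
  ... | tri< i<j _ _ = inj₂ (_ , proj₂ (meet i<j p q))
  ... | tri≈ _ i≡j _ = inj₁ i≡j
  ... | tri> _ _ j<i = inj₂ (_ , proj₂ (meet j<i q p))

  -- The node is a terminal of some part. If that is a part other than `i`, then `meet` makes it
  -- adjacent to part `i` in the chain, or contradicts the distinctness of terminals.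
  node∈⇒terminal : ∀ {c i} → node c ∈ V (part i) → c ≡ inject₁ i ⊎ c ≡ suc i
  node∈⇒terminal {c} {i} p with inject₁-or-suc i c
  ... | inj₁ (j , refl) with <-cmp i j
  ...   | tri< i<j _ _ = inj₂ (proj₁ (meet i<j p source∈V))
  ...   | tri≈ _ refl _ = inj₁ refl
  ...   | tri> _ _ j<i = contradiction (proj₂ (meet j<i source∈V p)) distinct
  node∈⇒terminal {c} {i} p | inj₂ (j , refl) with <-cmp i j
  ...   | tri< i<j _ _ = contradiction p (later-node∉ i<j)
  ...   | tri≈ _ refl _ = inj₂ refl
  ...   | tri> _ _ j<i = inj₁ (sym (proj₁ (meet j<i target∈V p)))

  -- An edge coming from another part would have both ends at the single shared node, hence be a
  -- loop.
  induced : ∀ {i u v} → u ∈ V (part i) → v ∈ V (part i) → Adj G u v → Adj (part i) u v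
  induced {i} {u} {v} p q e with locate-adj e
  ... | j , e′ with <-cmp i j
  ...   | tri< i<j _ _ = contradiction (subst₂ (Adj G) u≡ v≡ e) (N-irrefl G)
    where
    u≡ = proj₂ (meet i<j p (edge-source∈ (part j) e′))
    v≡ = proj₂ (meet i<j q (edge-target∈ (part j) e′))
  ...   | tri≈ _ refl _ = e′
  ...   | tri> _ _ j<i = contradiction (subst₂ (Adj G) u≡ v≡ e) (N-irrefl G)
    where
    u≡ = proj₂ (meet j<i (edge-source∈ (part j) e′) p)
    v≡ = proj₂ (meet j<i (edge-target∈ (part j) e′) q)

  -- The vertices of all parts preceding `node c`. The first disjunct adds something only for
  -- `c = zero`, where there are no such parts.
  Before : Fin (ℕ.suc k) → Fin n → Set
  Before c v = v ≡ node c ⊎ ∃ λ j → j < c × v ∈ V (part j)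

  ≤⇒before : ∀ {a c} → a ≤ c → Before c (node a)
  ≤⇒before {a} {c} a≤c with a ≟ c
  ... | yes refl = inj₁ refl
  ... | no  a≢c with view a
  ...   | ‵fromℕ = contradiction (toℕ-injective (ℕ.≤-antisym a≤c (≤fromℕ c))) a≢c
  ...   | ‵inject₁ j = inj₂ (j , subst (ℕ._< toℕ c) (toℕ-inject₁ j)
                               (ℕ.≤∧≢⇒< a≤c (a≢c ∘ toℕ-injective)) , source∈V)

  before⇒≤ : ∀ {a c} → Before c (node a) → a ≤ c
  before⇒≤ {a} (inj₁ eq) = ℕ.≤-reflexive (cong toℕ (node-injective eq))
  before⇒≤ (inj₂ (j , j<c , p)) with node∈⇒terminal p
  ... | inj₁ refl = ℕ.≤-trans (ℕ.≤-reflexive (toℕ-inject₁ j)) (ℕ.<⇒≤ j<c)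
  ... | inj₂ refl = j<c

  -- An edge out of the parts before `c` starts at a vertex shared with a later part. That vertex
  -- can only be `node c`, which the walk never leaves.
  reach⇒before : ∀ {c u v} → Before c u → Reach G (node c) u v → Before c v
  reach⇒before b ε = b
  reach⇒before (inj₁ u≡c) ((u≢c , _) ◅ _) = contradiction u≡c u≢c
  reach⇒before {c} (inj₂ (j , j<c , p)) ((u≢c , e) ◅ ws) with locate-adj e
  ... | l , e′ = reach⇒before (inj₂ (l , l<c , edge-target∈ (part l) e′)) ws
    where
    l<c : l < c
    l<c with toℕ l ℕ.<? toℕ c
    ... | yes l<c = l<c
    ... | no  l≮c with c≤l ← ℕ.≮⇒≥ l≮c
                  with eq , at ← meet (ℕ.<-≤-trans j<c c≤l) p (edge-source∈ (part l) e′) =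
      -- The indices are squeezed: `c ≤ l`, `l` is the successor of `j`, and `j < c`, so `suc j` is
      -- `c`.
      contradiction (trans at (cong node (toℕ-injective (ℕ.≤-antisym j<c
        (subst (toℕ c ℕ.≤_) (trans (sym (toℕ-inject₁ l)) (cong toℕ eq)) c≤l))))) u≢c

  -- A part before `c` contains `node c` only as its own target, so stopping at that target is
  -- enough.
  part-reach : ∀ {c j u v} → j < c → Reach (part j) (node (suc j)) u v → Reach G (node c) u v
  part-reach {suc i} {j} j<c = Star.map λ (x≢ , e) →
    (λ { refl → avoid x≢ (edge-source∈ (part j) e) }) , part-adj e
    where
    avoid : node (suc i) ≢ node (suc j) → node (suc i) ∉ V (part j)
    avoid ≢ p with node∈⇒terminal p
    ... | inj₁ eq = ℕ.<⇒≱ (ℕ.≤-reflexive (trans (cong toℕ eq) (toℕ-inject₁ j))) (ℕ.s≤s⁻¹ j<c)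
    ... | inj₂ eq = ≢ (cong node eq)

  node-reach : ∀ {c} a → a ≤ c → Reach G (node c) (node zero) (node a)
  node-reach {c} = <-weakInduction (λ a → a ≤ c → Reach G (node c) (node zero) (node a))
    (λ _ → ε)
    λ i ih i<c → ih (ℕ.≤-trans (ℕ.≤-reflexive (toℕ-inject₁ i)) (ℕ.<⇒≤ i<c))
                 ◅◅ part-reach i<c (fromSource target∈V)

  before⇒reach : ∀ {c v} → Before c v → Reach G (node c) (node zero) v
  before⇒reach {c} (inj₁ refl) = node-reach c ℕ.≤-refl
  before⇒reach {c} (inj₂ (j , j<c , p)) =
    node-reach (inject₁ j) (ℕ.≤-trans (ℕ.≤-reflexive (toℕ-inject₁ j)) (ℕ.<⇒≤ j<c))
    ◅◅ part-reach j<c (fromSource p)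

  before⇔reach : ∀ {c v} → Before c v ⇔ Reach G (node c) (node zero) v
  before⇔reach = mk⇔ before⇒reach (reach⇒before (≤⇒before z≤n))

  -- V (part j) is Before (j + 1) minus Before j, plus node j.
  part⇒before : ∀ {j v} → v ∈ V (part j) →
                Before (suc j) v × (Before (inject₁ j) v → v ≡ node (inject₁ j))
  part⇒before {j} {v} p = inj₂ (j , ℕ.≤-refl , p) , first
    where
    first : Before (inject₁ j) v → v ≡ node (inject₁ j)
    first (inj₁ eq) = eq
    first (inj₂ (l , l<j , q)) with eq , at ← meet (subst (toℕ l ℕ.<_) (toℕ-inject₁ j) l<j) q p =
      trans at (cong node (sym eq))

  before⇒part : ∀ {j v} → Before (suc j) v × (Before (inject₁ j) v → v ≡ node (inject₁ j)) →
                v ∈ V (part j)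
  before⇒part (inj₁ refl , _) = target∈V
  before⇒part {j} (inj₂ (l , l≤j , p) , first) with <-cmp l j
  ... | tri< l<j _ _ = subst (_∈ V (part j))
          (sym (first (inj₂ (l , subst (toℕ l ℕ.<_) (sym (toℕ-inject₁ j)) l<j , p)))) source∈V
  ... | tri≈ _ refl _ = p
  ... | tri> _ _ j<l = contradiction (ℕ.s≤s⁻¹ l≤j) (ℕ.<⇒≱ j<l)

  -- What non-serial parts contribute: no inner vertex of a part separates its terminals.
  Bypassable : Set
  Bypassable = ∀ i {c} → c ≢ node (inject₁ i) → c ≢ node (suc i) →
               Bypass (part i) c (node (inject₁ i)) (node (suc i))

  bypass-nodes : Bypassable → ∀ {c} → (∀ a → c ≢ node a) →
                 ∀ a → Bypass G c (node zero) (node a)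
  bypass-nodes by {c} c≢ = <-weakInduction (λ a → Bypass G c (node zero) (node a)) ε
    λ i ih → ih ◅◅ Star.map (λ (p , q , e) → p , q , part-adj e) (by i (c≢ _) (c≢ _))

reverse : Chain G k → Chain G k
reverse C = record
  { part  = part ∘ opposite
  ; node  = node ∘ opposite
  -- Only the source index needs rewriting; `opposite (suc i)` computes to the required target
  -- index.
  ; link  = λ i → subst (λ c → Link (part (opposite i)) (node c) (node (inject₁ (opposite i))))
                    (sym (opposite-inject₁ i)) (link-reverse (link (opposite i)))
  ; meet  = λ {i} {j} i<j p q → let eq , at = meet (opposite-anti-< i<j) q p in
              opposite-injective (trans (opposite-inject₁ j) (sym eq))
            , trans at (cong node (sym eq))
  ; union = record
      { vertices = λ v → mk⇔
          (reindex (λ i → v ∈ V (part i)) ∘ Equivalence.to (vertices v))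
          (λ (i , p) → Equivalence.from (vertices v) (opposite i , p))
      ; edges = λ u v → mk⇔
          (reindex (λ i → Adj (part i) u v) ∘ Equivalence.to (edges u v))
          (λ (i , e) → Equivalence.from (edges u v) (opposite i , e))
      }
  }
  where
  open Chain C
  open IsUnion union

  reindex : (P : Fin _ → Set) → ∃ P → ∃ (P ∘ opposite)
  reindex P (i , p) = opposite i , subst P (sym (opposite-involutive i)) p

reverse-bypassable : (C : Chain G k) → Chain.Bypassable C → Chain.Bypassable (reverse C)
reverse-bypassable C by i {c} c≢s c≢t = bypass-reverse (part (opposite i))
  (subst (λ a → Bypass (part (opposite i)) c (node (inject₁ (opposite i))) (node a)) (sym (opposite-inject₁ i))
    (by (opposite i) c≢t (c≢s ∘ λ eq → trans eq (cong node (sym (opposite-inject₁ i))))))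
  where open Chain C

-- Every part lies before the last node, so this is the walk description of `Before` at the top
-- index.
chain-reach : (C : Chain G k) → let open Chain C in
              v ∈ V G → Reach G (node (fromℕ k)) (node zero) v
chain-reach C v∈ with j , p ← Chain.locate C (_ , v∈) =
  Chain.before⇒reach C (inj₂ (j , subst (toℕ j ℕ.<_) (sym (toℕ-fromℕ _)) (toℕ<n j) , p))

-- Series-parallel graphs

-- The links are an argument so that the recursion in `sp-link` can supply them.
serial-chain : (D : Serial G s t) → (∀ i → Link (Serial.part D i) _ _) → Chain G (Serial.k D)
serial-chain D links = record
  { part = part ; node = node ; link = links ; meet = meet ; union = union }
  where
  open Serial D

  meet : ∀ {i j v} → i < j → v ∈ V (part i) → v ∈ V (part j) →
         inject₁ j ≡ suc i × v ≡ node (suc i)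
  meet {i} {j} {v} i<j p q with toℕ j ℕ.≟ ℕ.suc (toℕ i)
  ... | yes eq = inject₁≡suc eq , trans (x∈⁅y⁆⇒x≡y _ (subst (v ∈_) (consecutive i j eq) (x∈p∩q⁺ (p , q))))
                                        (cong node (inject₁≡suc eq))
  ... | no  j≢ = contradiction (subst (v ∈_) (distant i j gap) (x∈p∩q⁺ (p , q))) ∉⊥
    where
    gap : 2 ℕ.≤ ℕ.∣ toℕ i - toℕ j ∣
    gap = subst (2 ℕ.≤_) (sym (ℕ.m≤n⇒∣m-n∣≡n∸m (ℕ.<⇒≤ i<j)))
            (ℕ.m+n≤o⇒m≤o∸n 2 (ℕ.≤∧≢⇒< i<j (j≢ ∘ sym)))

-- Induction on the decomposition. Parallel parts have the terminals of `G`, so their walks serve in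
-- `G`; in the serial case the walks run along the chain of parts.
sp-link : SeriesParallel G s t → Link G s t
sp-link {G = G} {s} {t} sp@(edge e) = record
  { source∈V = source∈ sp ; target∈V = target∈ sp ; distinct = s≢t
  ; fromSource = λ v∈ → from-s (∈pair⁻ (subst (_ ∈_) vertices v∈))
  ; fromTarget = λ v∈ → from-t (∈pair⁻ (subst (_ ∈_) vertices v∈)) }
  where
  open IsEdge e
  from-s : v ≡ s ⊎ v ≡ t → Reach G t s v
  from-s (inj₁ refl) = ε
  from-s (inj₂ refl) = (s≢t , adjacent) ◅ ε
  from-t : v ≡ s ⊎ v ≡ t → Reach G s t v
  from-t (inj₁ refl) = (s≢t ∘ sym , N-sym G adjacent) ◅ ε
  from-t (inj₂ refl) = ε
sp-link {G = G} {s} {t} sp@(serial D) = record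
  { source∈V = source∈ sp ; target∈V = target∈ sp ; distinct = Serial.s≢t D
  ; fromSource = λ {v} v∈ → subst₂ (λ x y → Reach G y x v) node-first node-last (chain-reach C v∈)
  -- Walks from `t` are walks from the first node of the reversed chain.
  ; fromTarget = λ {v} v∈ → subst₂ (λ x y → Reach G x y v)
      (trans (cong node (opposite-involutive zero)) node-first) node-last (chain-reach (reverse C) v∈) }
  where
  open Serial D using (node; node-first; node-last; part-sp)
  C = serial-chain D (λ i → sp-link (part-sp i))
sp-link {G = G} {s} {t} sp@(parallel P) = record
  { source∈V = source∈ sp ; target∈V = target∈ sp ; distinct = s≢t
  ; fromSource = λ {v} v∈ → let i , p = Equivalence.to (vertices v) v∈ in
      Star.map (λ (x≢ , e) → x≢ , Equivalence.from (edges _ _) (i , e)) (Link.fromSource (sp-link (part-sp i)) p)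
  ; fromTarget = λ {v} v∈ → let i , p = Equivalence.to (vertices v) v∈ in
      Star.map (λ (x≢ , e) → x≢ , Equivalence.from (edges _ _) (i , e)) (Link.fromTarget (sp-link (part-sp i)) p) }
  where
  open Parallel P
  open IsUnion union

-- Two parts meet only in the terminals, so one of the first two misses `c`.
some-part-avoids : (P : Parallel G s t) → ∀ {c} → c ≢ s → c ≢ t →
                   ∃ λ i → c ∉ V (Parallel.part P i)
some-part-avoids
  record { k = ℕ.suc (ℕ.suc _) ; 2≤k = s≤s (s≤s _) ; part = part ; meet = meet } {c} c≢s c≢t
  with c ∈? V (part zero)
... | no  c∉ = zero , c∉
... | yes c∈ = suc zero , λ c∈′ → Sum.[ c≢s , c≢t ]
      (∈pair⁻ (subst (c ∈_) (meet zero (suc zero) λ ()) (x∈p∩q⁺ (c∈ , c∈′))))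

-- In the parallel case the walk runs inside a part that does not contain `c`.
nonserial-bypass : SeriesParallel G s t → NonSerial G s t →
                   ∀ {c} → c ≢ s → c ≢ t → Bypass G c s t
nonserial-bypass (edge e) _ c≢s c≢t =
  (c≢s ∘ sym , c≢t ∘ sym , IsEdge.adjacent e) ◅ ε
nonserial-bypass (serial D) ns _ _ = contradiction D ns
nonserial-bypass (parallel P) _ c≢s c≢t with i , c∉ ← some-part-avoids P c≢s c≢t =
  Star.map (λ (p , q , e) → p , q , Equivalence.from (IsUnion.edges union _ _) (i , e))
    (reach⇒bypass (part i) c∉ (Link.fromSource (sp-link (part-sp i)) (target∈ (part-sp i))))
  where open Parallel P

-- Matchings between chains

-- With `C′` the reverse of `C` this amounts to a `Reversal`. Allowing two different chains makes
-- the notion invertible.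
record Matching {n k} {G H : Graph n} (C : Chain G k) (C′ : Chain H k) : Set where
  private
    module C  = Chain C
    module C′ = Chain C′
  field
    ρ        : ∀ i → Vertex (C.part i) → Vertex (C′.part i)
    ρ-iso    : ∀ i → IsIso (C.part i) (C′.part i) (ρ i)
    ρ-source : ∀ i p → proj₁ (ρ i (C.node (inject₁ i) , p)) ≡ C′.node (inject₁ i)
    ρ-target : ∀ i p → proj₁ (ρ i (C.node (suc i) , p)) ≡ C′.node (suc i)

  ρ-node : ∀ {i} c (p : C.node c ∈ V (C.part i)) → proj₁ (ρ i (C.node c , p)) ≡ C′.node c
  ρ-node c p with C.node∈⇒terminal p
  ... | inj₁ refl = ρ-source _ p
  ... | inj₂ refl = ρ-target _ p

  -- Different parts share only nodes, and each `ρ i` sends a node to the node of the same index.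
  ρ-consistent : ∀ {i j v} (p : v ∈ V (C.part i)) (q : v ∈ V (C.part j)) →
                 proj₁ (ρ i (v , p)) ≡ proj₁ (ρ j (v , q))
  ρ-consistent p q with C.shared p q
  ... | inj₁ refl       = cong (λ r → proj₁ (ρ _ (_ , r))) ([]=-irrelevant p q)
  ... | inj₂ (c , refl) = trans (ρ-node c p) (sym (ρ-node c q))

  Restricts : (Vertex G → Vertex H) → Set
  Restricts f = ∀ i v → proj₁ (f (C.incl i v)) ≡ proj₁ (ρ i v)

  -- The part chosen by `locate` does not matter, by `ρ-consistent`.
  glue : Vertex G → Vertex H
  glue v = let i , p = C.locate v in C′.incl i (ρ i (_ , p))

  glue-restricts : Restricts glue
  glue-restricts i v = ρ-consistent _ _

  restricts-at : ∀ f → Restricts f → ∀ {i} v (p : proj₁ v ∈ V (C.part i)) →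
                 f v ≡ C′.incl i (ρ i (proj₁ v , p))
  restricts-at f R v p = trans (cong f (vertex-≡ {G = G} refl)) (vertex-≡ {G = H} (R _ (_ , p)))

  restricts-node : ∀ f → Restricts f → ∀ v c → proj₁ v ≡ C.node c → proj₁ (f v) ≡ C′.node c
  restricts-node f R v c refl with i , p ← C.locate v =
    trans (cong proj₁ (restricts-at f R v p)) (ρ-node c p)

  restricts-adj : ∀ f → Restricts f → ∀ u v →
                  Adj G (proj₁ u) (proj₁ v) → Adj H (proj₁ (f u)) (proj₁ (f v))
  restricts-adj f R u v e with i , e′ ← C.locate-adj e =
    subst₂ (λ x y → Adj H (proj₁ x) (proj₁ y))
      (sym (restricts-at f R u (edge-source∈ (C.part i) e′)))
      (sym (restricts-at f R v (edge-target∈ (C.part i) e′)))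
      (C′.part-adj (iso-adj (ρ-iso i) e′))

open Matching using (Restricts; restricts-at; restricts-adj; glue; glue-restricts)

matching-inverse : {C : Chain G k} {C′ : Chain H k} → Matching C C′ → Matching C′ C
matching-inverse {C = C} {C′} M = record
  { ρ = λ i → inverse (ρ-iso i)
  ; ρ-iso = λ i → inverse-iso (ρ-iso i)
  ; ρ-source = λ i p → cong proj₁ (back i (ρ-source i (Chain.source∈V C)))
  ; ρ-target = λ i p → cong proj₁ (back i (ρ-target i (Chain.target∈V C)))
  }
  where
  open Matching M
  back : ∀ i {u w} → proj₁ (ρ i u) ≡ proj₁ w → inverse (ρ-iso i) w ≡ u
  back i {u} {w} eq = trans (cong (inverse (ρ-iso i)) (vertex-≡ {G = Chain.part C′ i} (sym eq)))
                            (inverseˡ (ρ-iso i) u)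

restricts-cancel : {C : Chain G k} {C′ : Chain H k} (M : Matching C C′) →
  ∀ f g → Restricts M f → Restricts (matching-inverse M) g → ∀ v → g (f v) ≡ v
restricts-cancel {G = G} {C = C} M f g R S v with i , p ← Chain.locate C v =
  vertex-≡ {G = G} (begin
    proj₁ (g (f v))                            ≡⟨ cong (proj₁ ∘ g) (restricts-at M f R v p) ⟩
    proj₁ (g _)                                ≡⟨ S i _ ⟩
    proj₁ (inverse (ρ-iso i) (ρ i (_ , p)))    ≡⟨ cong proj₁ (inverseˡ (ρ-iso i) _) ⟩
    proj₁ v                                    ∎)
  where
  open Matching M using (ρ; ρ-iso)
  open ≡-Reasoning

-- The inverse is glued from the inverses of the `ρ i`. Each edge lies in a single part, so
-- adjacency is preserved in both directions.
restricts-iso : {C : Chain G k} {C′ : Chain H k} (M : Matching C C′) →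
                ∀ f → Restricts M f → IsIso G H f
restricts-iso {G = G} M f R = record
  { bijective = (λ {u} {v} eq → trans (sym (gf u)) (trans (cong g eq) (gf v)))
              , λ w → g w , λ { refl → restricts-cancel M⁻¹ g f S R w }
  ; adjacency = λ u v → mk⇔ (restricts-adj M f R u v)
      (subst₂ (λ x y → Adj G (proj₁ x) (proj₁ y)) (gf u) (gf v) ∘ restricts-adj M⁻¹ g S (f u) (f v))
  }
  where
  M⁻¹ = matching-inverse M
  g = glue M⁻¹
  S = glue-restricts M⁻¹
  gf = restricts-cancel M f g R S

-- Rigidity of the serial decomposition

module Rigidity {n k} {G H : Graph n} {C : Chain G k} {C′ : Chain H k} (bypass : Chain.Bypassable C′)
  {φ : Vertex G → Vertex H} (I : IsIso G H φ)
  (φ-first : ∀ p → proj₁ (φ (Chain.node C zero , p)) ≡ Chain.node C′ zero)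
  (φ-last  : ∀ p → proj₁ (φ (Chain.node C (fromℕ k) , p)) ≡ Chain.node C′ (fromℕ k))
  (node∈   : ∀ c → Chain.node C c ∈ V G) where
  private
    module C  = Chain C
    module C′ = Chain C′

  vertex : Fin (ℕ.suc k) → Vertex G
  vertex c = C.node c , node∈ c

  reach⁻ : ∀ {c u v} → Reach H (proj₁ (φ c)) (proj₁ (φ u)) (proj₁ (φ v)) →
           Reach G (proj₁ c) (proj₁ u) (proj₁ v)
  reach⁻ {c} {u} {v} ws = subst₂ (λ x y → Reach G (proj₁ c) (proj₁ x) (proj₁ y))
    (inverseˡ I u) (inverseˡ I v)
    (subst (λ x → Reach G (proj₁ x) (proj₁ (inverse I (φ u))) (proj₁ (inverse I (φ v)))) (inverseˡ I c)
      (iso-reach (inverse-iso I) ws))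

  -- If the image of a node other than the last were not a node, the bypasses in `H` would join the
  -- first node to the last around it. Pulled back to `G`, this walk would put the last node before
  -- `c`.
  node-image : ∀ c → ∃ λ d → proj₁ (φ (vertex c)) ≡ C′.node d
  node-image c with any? (λ d → proj₁ (φ (vertex c)) ≟ C′.node d)
  ... | yes image = image
  ... | no  ¬image with view c
  ...   | ‵fromℕ = contradiction (_ , φ-last _) ¬image
  ...   | ‵inject₁ j = contradiction (C.before⇒≤ top-before) (ℕ.<⇒≱ inject₁<fromℕ)
    where
    inject₁<fromℕ : inject₁ j < fromℕ k
    inject₁<fromℕ = subst₂ ℕ._<_ (sym (toℕ-inject₁ j)) (sym (toℕ-fromℕ k)) (toℕ<n j)

    detour : Reach H (proj₁ (φ (vertex (inject₁ j)))) (C′.node zero) (C′.node (fromℕ k))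
    detour = Star.map (λ (x≢ , _ , e) → x≢ , e)
      (C′.bypass-nodes bypass (λ d eq → ¬image (d , eq)) (fromℕ k))

    top-before : C.Before (inject₁ j) (C.node (fromℕ k))
    top-before = Equivalence.from C.before⇔reach
      (reach⁻ {vertex (inject₁ j)} {vertex zero} {vertex (fromℕ k)}
        (subst₂ (Reach H _) (sym (φ-first _)) (sym (φ-last _)) detour))

  -- `Before` is characterised by walks alone, and `φ` carries walks both ways.
  before⇔ : ∀ {c d v} → proj₁ (φ (vertex c)) ≡ C′.node d →
            C.Before c (proj₁ v) ⇔ C′.Before d (proj₁ (φ v))
  before⇔ {c} {d} {v} eq = mk⇔
    (λ b → Equivalence.from C′.before⇔reach (subst₂ (λ x y → Reach H x y (proj₁ (φ v))) eq (φ-first _)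
      (iso-reach I {vertex c} {vertex zero} {v} (Equivalence.to C.before⇔reach b))))
    (λ b → Equivalence.from C.before⇔reach (reach⁻ {vertex c} {vertex zero} {v}
      (subst₂ (λ x y → Reach H x y (proj₁ (φ v))) (sym eq) (sym (φ-first _))
        (Equivalence.to C′.before⇔reach b))))

  label-injective : ∀ {u v} → proj₁ (φ u) ≡ proj₁ (φ v) → proj₁ u ≡ proj₁ v
  label-injective eq = cong proj₁ (iso-injective I (vertex-≡ {G = H} eq))

  π : Fin (ℕ.suc k) → Fin (ℕ.suc k)
  π c = proj₁ (node-image c)

  -- The order of nodes can be read off from `Before`, which `φ` respects; strictness comes from
  -- injectivity. It forces `π` to be the identity.
  π-mono : ∀ {a b} → a < b → π a < π b
  π-mono {a} {b} a<b = ℕ.≤∧≢⇒< (C′.before⇒≤ πa-before) λ eq →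
    ℕ.<⇒≢ a<b (cong toℕ (C.node-injective (label-injective
      (trans (proj₂ (node-image a))
        (trans (cong C′.node (toℕ-injective eq)) (sym (proj₂ (node-image b))))))))
    where
    πa-before : C′.Before (π b) (C′.node (π a))
    πa-before = subst (C′.Before (π b)) (proj₂ (node-image a))
      (Equivalence.to (before⇔ {v = vertex a} (proj₂ (node-image b))) (C.≤⇒before (ℕ.<⇒≤ a<b)))

  φ-node : ∀ c → proj₁ (φ (vertex c)) ≡ C′.node c
  φ-node c = trans (proj₂ (node-image c)) (cong C′.node (strictMono⇒id π π-mono c))

  -- A part is described by `Before` at its two ends together with its source, and `φ` preserves
  -- each of these.
  part⇔ : ∀ {j v} → proj₁ v ∈ V (C.part j) ⇔ proj₁ (φ v) ∈ V (C′.part j)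
  part⇔ {j} {v} = mk⇔
    (λ p → let b , first = C.part⇒before p in C′.before⇒part
      ( to (suc j) b
      , λ b′ → trans (cong (proj₁ ∘ φ) (vertex-≡ {G = G} (first (from (inject₁ j) b′)))) (φ-node _)))
    (λ p → let b , first = C′.part⇒before p in C.before⇒part
      ( from (suc j) b
      , λ b′ → label-injective {v} {vertex (inject₁ j)}
                 (trans (first (to (inject₁ j) b′)) (sym (φ-node _)))))
    where
    to : ∀ c → C.Before c (proj₁ v) → C′.Before c (proj₁ (φ v))
    to c = Equivalence.to (before⇔ {v = v} (φ-node c))
    from : ∀ c → C′.Before c (proj₁ (φ v)) → C.Before c (proj₁ v)
    from c = Equivalence.from (before⇔ {v = v} (φ-node c))

  matching : Matching C C′
  matching = record
    { ρ = ρ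
    ; ρ-iso = λ j → record
        { bijective = (λ eq → vertex-≡ {G = C.part j} (label-injective (cong proj₁ eq)))
                    , λ (w , q) → let v = inverse I (C′.incl j (w , q))
                                      φv≡ = cong proj₁ (inverseʳ I (C′.incl j (w , q)))
                                      p = Equivalence.from (part⇔ {j} {v})
                                            (subst (_∈ V (C′.part j)) (sym φv≡) q) in
                        (proj₁ v , p) ,
                        λ { refl → vertex-≡ {G = C′.part j}
                              (trans (cong (proj₁ ∘ φ) (vertex-≡ {G = G} refl)) φv≡) }
        ; adjacency = λ u v → mk⇔
            -- The map is a restriction of `φ`, and parts are induced subgraphs, so adjacency in a
            -- part is adjacency in the whole graph.
            (λ e → C′.induced (proj₂ (ρ j u)) (proj₂ (ρ j v)) (iso-adj I (C.part-adj e)))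
            (λ e → C.induced (proj₂ u) (proj₂ v)
              (Equivalence.from (IsIso.adjacency I (C.incl j u) (C.incl j v)) (C′.part-adj e)))
        }
    ; ρ-source = λ i p → trans (cong (proj₁ ∘ φ) (vertex-≡ {G = G} refl)) (φ-node (inject₁ i))
    ; ρ-target = λ i p → trans (cong (proj₁ ∘ φ) (vertex-≡ {G = G} refl)) (φ-node (suc i))
    }
    where
    ρ : ∀ j → Vertex (C.part j) → Vertex (C′.part j)
    ρ j (v , p) = proj₁ (φ (C.incl j (v , p))) , Equivalence.to part⇔ p

-- Automorphisms of a serial superedge

Swaps : {X : Set} (a b : X) → (X → X) → Set
Swaps a b f = f a ≡ b × f b ≡ a

or⇒semi : ∀ {a b : Vertex G} {σ} → AutOr G a b σ → AutSemi G a b σ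
or⇒semi (I , σa , σb) = I , cong₂ pair (cong proj₁ σa) (cong proj₁ σb)

swaps⇒semi : ∀ {a b : Vertex G} {σ} → IsIso G G σ → Swaps a b σ → AutSemi G a b σ
swaps⇒semi {a = a} {b} I (σa , σb) = I ,
  trans (cong₂ pair (cong proj₁ σa) (cong proj₁ σb)) (∪-comm _ _)

semi⇒or⊎swaps : ∀ {a b : Vertex G} {σ} → a ≢ b → AutSemi G a b σ → AutOr G a b σ ⊎ Swaps a b σ
semi⇒or⊎swaps {G = G} {a} {b} {σ} a≢b (I , eq)
  with ∈pair⁻ {u = proj₁ a} (subst (proj₁ (σ a) ∈_) eq (∈pair⁺ (inj₁ refl)))
     | ∈pair⁻ {u = proj₁ a} (subst (proj₁ (σ b) ∈_) eq (∈pair⁺ (inj₂ refl)))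
... | inj₁ σa | inj₂ σb = inj₁ (I , vertex-≡ {G = G} σa , vertex-≡ {G = G} σb)
... | inj₂ σa | inj₁ σb = inj₂ (vertex-≡ {G = G} σa , vertex-≡ {G = G} σb)
-- The two remaining cases send both terminals to one vertex, against injectivity.
... | inj₁ σa | inj₁ σb = contradiction (iso-injective I (vertex-≡ {G = G} (trans σa (sym σb)))) a≢b
... | inj₂ σa | inj₂ σb = contradiction (iso-injective I (vertex-≡ {G = G} (trans σa (sym σb)))) a≢b

semi≐withReversed : ∀ {a b : Vertex G} {r} → a ≢ b → IsIso G G r → Swaps a b r →
                    AutSemi G a b ≐ WithReversed r (AutOr G a b)
semi≐withReversed {G = G} {a} {b} {r} a≢b I (ra , rb) = to , from
  where
  to : ∀ {φ} → AutSemi G a b φ → WithReversed r (AutOr G a b) φ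
  to {φ} semi with semi⇒or⊎swaps a≢b semi
  ... | inj₁ or = φ , or , inj₁ λ _ → refl
  ... | inj₂ (φa , φb) = inverse I ∘ φ
        , ( iso-∘ (inverse-iso I) (proj₁ semi)
          , trans (cong (inverse I) (trans φa (sym ra))) (inverseˡ I a)
          , trans (cong (inverse I) (trans φb (sym rb))) (inverseˡ I b))
        , inj₂ λ v → sym (inverseʳ I (φ v))

  from : ∀ {φ} → WithReversed r (AutOr G a b) φ → AutSemi G a b φ
  from (σ , (J , σa , σb) , inj₁ φ≗σ) =
    or⇒semi (iso-≗ φ≗σ J , trans (φ≗σ a) σa , trans (φ≗σ b) σb)
  from (σ , (J , σa , σb) , inj₂ φ≗rσ) =
    swaps⇒semi (iso-≗ φ≗rσ (iso-∘ I J))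
      (trans (φ≗rσ a) (trans (cong r σa) ra) , trans (φ≗rσ b) (trans (cong r σb) rb))

module _ {n} {G : Graph n} {s t : Fin n} (D : Serial G s t) where
  open Serial D renaming (k to len)

  chain : Chain G len
  chain = serial-chain D (λ i → sp-link (part-sp i))

  reversal⇒matching : Reversal D → Matching chain (reverse chain)
  reversal⇒matching R = record
    { ρ = ρ
    ; ρ-iso = ρ-iso
    ; ρ-source = λ i p → trans (cong (proj₁ ∘ ρ i) (vertex-≡ {G = part i} refl))
        (trans (cong proj₁ (ρ-source i)) (cong node (sym (opposite-inject₁ i))))
    ; ρ-target = λ i p → trans (cong (proj₁ ∘ ρ i) (vertex-≡ {G = part i} refl))
        (cong proj₁ (ρ-target i))
    }
    where open Reversal R

  matching⇒reversal : Matching chain (reverse chain) → Reversal D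
  matching⇒reversal M = record
    { ρ = ρ
    ; ρ-iso = ρ-iso
    ; ρ-source = λ i → vertex-≡ {G = part (opposite i)}
        (trans (ρ-source i _) (cong node (opposite-inject₁ i)))
    ; ρ-target = λ i → vertex-≡ {G = part (opposite i)} (ρ-target i _)
    }
    where open Matching M

  private
    a = source (serial D)
    b = target (serial D)

  opposite-last : node (opposite (fromℕ len)) ≡ s
  opposite-last = trans (cong node (opposite-involutive zero)) node-first

  -- The terminals are the first and last nodes, and the reversed chain has `t` first and `s` last.
  reversing-map-swaps : (R : Reversal D) → ∀ r → RestrictsTo D R r → Swaps a b r
  reversing-map-swaps R r r-restricts =
      vertex-≡ {G = G} (trans (at a zero (sym node-first)) node-last)
    , vertex-≡ {G = G} (trans (at b (fromℕ len) (sym node-last)) opposite-last)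
    where
    at = Matching.restricts-node (reversal⇒matching R) r (λ i v → cong proj₁ (r-restricts i v))

  -- A swap sends the end nodes of `chain` to those of its reverse, so rigidity applies to these two
  -- chains.
  swap⇒reversal : (∀ i → NonSerial (part i) (node (inject₁ i)) (node (suc i))) →
                  ∀ {φ} → IsIso G G φ → Swaps a b φ → Reversal D
  swap⇒reversal nonserial {φ} I (φa , φb) = matching⇒reversal
    (Rigidity.matching {C = chain} {C′ = reverse chain}
      (reverse-bypassable chain λ i → nonserial-bypass (part-sp i) (nonserial i))
      I
      (λ p → trans (cong (proj₁ ∘ φ) (vertex-≡ {G = G} node-first))
               (trans (cong proj₁ φa) (sym node-last)))
      (λ p → trans (cong (proj₁ ∘ φ) (vertex-≡ {G = G} node-last))
               (trans (cong proj₁ φb) (sym opposite-last)))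
      -- Part zero exists because `2 ≤ len`, which shows that the chain is not empty.
      (Chain.node∈ chain (fromℕ< {0} (ℕ.≤-trans (s≤s z≤n) 2≤k))))

theorem6p4 : ∀ {n} {G : Graph n} {s t : Fin n} (D : Serial G s t) →
    let open Serial D
        a = source (serial D)
        b = target (serial D)
    in
    (∀ i → NonSerial (part i) (node (inject₁ i)) (node (suc i))) →
    ((R : Reversal D) →
       (∃ λ r → RestrictsTo D R r) ×
       (∀ r → RestrictsTo D R r → AutSemi G a b ≐ WithReversed r (AutOr G a b)))
    × (¬ Reversal D → AutSemi G a b ≐ AutOr G a b)
theorem6p4 {G = G} {s} {t} D nonserial =
    (λ R → let M = reversal⇒matching D R in
        (glue M , λ i v → vertex-≡ {G = G} (glue-restricts M i v))
      , λ r r-restricts → semi≐withReversed a≢b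
          (restricts-iso M r λ i v → cong proj₁ (r-restricts i v))
          (reversing-map-swaps D R r r-restricts))
  , λ ¬R →
      (λ semi → Sum.[ (λ or → or)
                    , (λ swaps → contradiction (swap⇒reversal D nonserial (proj₁ semi) swaps) ¬R)
                    ] (semi⇒or⊎swaps a≢b semi))
    , or⇒semi
  where
  a≢b : source (serial D) ≢ target (serial D)
  a≢b = Serial.s≢t D ∘ cong proj₁
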